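{- Let $P$ be any of cost-SR, cost-PR, cost-SPR, cost-LPR, cost-BC. The system MaxSAT resolution $+$ $P$ is complete: for every MaxSAT instance with satisfiable hard clauses $H_0=\{C_1\lor b_1,\dots,C_m\lor b_m\}$ and soft clauses $S_0=\{\lnot b_1,\dots,\lnot b_m\}$ and with $\mathrm{cost}(H_0)=k$, there is a MaxSAT resolution $+$ $P$ derivation $(H_0,S_0),\dots,(H_t,S_t)$ such that $S_t$ contains $k$ copies of the empty clause $\bot$.
   Context: $b_1,\dots,b_m$ are distinct blocking variables not occurring in $C_1,\dots,C_m$; $\mathrm{cost}(\alpha)=\sum_i\alpha(b_i)$, $\mathrm{cost}(H)=\min\{\mathrm{cost}(\alpha):\alpha\text{ total},\alpha\models H\}$. Notation: substitutions map variables to $0,1$ or literals; $(\sigma\circ\tau)(x)=\sigma(\tau(x))$; $C{\upharpoonright}_\sigma$ and $\Gamma{\upharpoonright}_\sigma$ denote restriction (clauses set to $1$ removed); $\lnot C$ is the partial assignment falsifying $C$; $\Gamma\vdash_1 C$ means unit propagation on $\Gamma{\upharpoonright}_{\lnot C}$ derives $\bot$. $C$ is cost-SR w.r.t. $\Gamma$ if some substitution $\sigma$ satisfies (1) $\Gamma{\upharpoonright}_{\lnot C}\vdash_1(\Gamma\cup\{C\}){\upharpoonright}_\sigma$ and (2) $\mathrm{cost}(\tau\circ\sigma)\le\mathrm{cost}(\tau)$ for all total $\tau\supseteq\lnot C$; cost-PR if $\sigma$ can be a partial assignment; cost-SPR if a partial assignment with the same domain as $\lnot C$; cost-LPR if moreover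 it differs from $\lnot C$ on exactly one variable. $C\lor\ell$ is cost-BC w.r.t. $\Gamma$ if for every $D\lor\lnot\ell\in\Gamma$, $C\lor D$ is a tautology, and $\ell$ is not a positive blocking variable. A MaxSAT resolution $+$ $P$ derivation is a sequence of pairs of multisets $(H_i,S_i)$ where each step is one of: (a) $S_i=S_{i-1}$, $H_i=H_{i-1}\cup\{C\}$ with $C$ obtained by resolution (or weakening) from $H_{i-1}$; (a') $S_i=S_{i-1}$, $H_i=H_{i-1}\cup\{C\}$ with $C$ satisfying $P$ w.r.t. $H_{i-1}$; (b) $S_i=S_{i-1}\cup\{C\}$ for some $C\in H_{i-1}$, $H_i=H_{i-1}$; (c) $S_i=S_{i-1}\setminus\{C\}\cup\{C\lor x,C\lor\lnot x\}$ for $C\in S_{i-1}$, $H_i=H_{i-1}$; (d) $S_i=S_{i-1}\setminus\{C\lor x,C\lor\lnot x\}\cup\{C\}$ for $\{C\lor x,C\lor\lnot x\}\subseteq S_{i-1}$, $H_i=H_{i-1}$. -}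

module Defs where

open import Data.Bool using (Bool; true; false; not; if_then_else_)
import Data.Bool.Properties as Bool
open import Data.Fin using (Fin)
import Data.Fin.Properties as Fin
open import Data.List using (List; []; _∷_; [_]; _++_; mapMaybe; replicate; tabulate)
open import Data.List.Membership.Propositional using (_∈_)
import Data.List.Membership.DecPropositional as DecMembership
import Data.List.Membership.Setoid as SetoidMembership
open import Data.List.Relation.Binary.BagAndSetEquality using ([_]-Equality; set)
import Data.List.Relation.Binary.Permutation.Setoid as SetoidPermutation
open import Data.List.Relation.Binary.Subset.Propositional using (_⊆_)
open import Data.List.Relation.Unary.All using (All)
open import Data.List.Relation.Unary.Any using (Any)
import Data.Maybe as Maybe
open import Data.Maybe using (Maybe; just; nothing; Is-just)
open import Data.Nat using (ℕ; _≤_)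
open import Data.Nat.ListAction using (sum)
open import Data.Product using (_×_; _,_; ∃-syntax; ∃!)
open import Data.Product.Properties using (≡-dec)
open import Data.Sum using (_⊎_)
open import Function using (_⇔_)
open import Level using (0ℓ)
open import Relation.Binary.Bundles using (Setoid)
open import Relation.Binary.Construct.Closure.ReflexiveTransitive using (Star)
open import Relation.Binary.Definitions using (DecidableEquality)
open import Relation.Binary.PropositionalEquality using (_≡_; _≢_)
open import Relation.Nullary using (Dec; ¬_; does)

-- The propositional variables are named by Fin n; assignments are total on Fin n,
-- and derivations stay within these variables.

Literal : ℕ → Set
Literal n = Fin n × Bool

pattern pos x = x , true
pattern neg x = x , false

infix 8 ~_

~_ : ∀ {n} → Literal n → Literal n
~ (x , s) = x , not s

-- A clause is a set of literals and a formula (or a collection of soft clauses)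
-- is a multiset of clauses.  Both are represented by lists: clauses are compared
-- by mutual inclusion (_≈_) and multisets by permutation modulo _≈_ (_↭_).
-- Thus ℓ ∷ C is C ∨ ℓ, C ++ D is C ∨ D, and [] is the empty clause.

Clause : ℕ → Set
Clause n = List (Literal n)

Formula : ℕ → Set
Formula n = List (Clause n)

clauseSetoid : ℕ → Setoid 0ℓ 0ℓ
clauseSetoid n = [ set ]-Equality (Literal n)

module _ {n : ℕ} where
  open Setoid (clauseSetoid n) public using (_≈_)
  open SetoidMembership (clauseSetoid n) public using () renaming (_∈_ to _∈ᶜ_)
  open SetoidPermutation (clauseSetoid n) public using (_↭_)

_≟ˡ_ : ∀ {n} → DecidableEquality (Literal n)
_≟ˡ_ = ≡-dec Fin._≟_ Bool._≟_

_∈?_ : ∀ {n} (ℓ : Literal n) (C : Clause n) → Dec (ℓ ∈ C)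
_∈?_ {n} = DecMembership._∈?_ (_≟ˡ_ {n})

_occursIn_ : ∀ {n} → Fin n → Clause n → Set
x occursIn C = pos x ∈ C ⊎ neg x ∈ C

Tautology : ∀ {n} → Clause n → Set
Tautology C = ∃[ x ] pos x ∈ C × neg x ∈ C

Assignment : ℕ → Set
Assignment n = Fin n → Bool

PartialAssignment : ℕ → Set
PartialAssignment n = Fin n → Maybe Bool

data Value (n : ℕ) : Set where
  const : Bool → Value n
  lit   : Literal n → Value n

Substitution : ℕ → Set
Substitution n = Fin n → Value n

-- Variables outside the domain of a partial assignment are left unchanged.
⌜_⌝ : ∀ {n} → PartialAssignment n → Substitution n
⌜ ρ ⌝ x = Maybe.maybe′ const (lit (pos x)) (ρ x)

negate : ∀ {n} → Value n → Value n
negate (const v) = const (not v)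
negate (lit ℓ)   = lit (~ ℓ)

_⟨_⟩ : ∀ {n} → Substitution n → Literal n → Value n
σ ⟨ pos x ⟩ = σ x
σ ⟨ neg x ⟩ = negate (σ x)

evalLiteral : ∀ {n} → Assignment n → Literal n → Bool
evalLiteral τ (pos x) = τ x
evalLiteral τ (neg x) = not (τ x)

eval : ∀ {n} → Assignment n → Value n → Bool
eval τ (const v) = v
eval τ (lit ℓ)   = evalLiteral τ ℓ

_⊙_ : ∀ {n} → Assignment n → Substitution n → Assignment n
(τ ⊙ σ) x = eval τ (σ x)

_⊇_ : ∀ {n} → Assignment n → PartialAssignment n → Set
τ ⊇ ρ = ∀ x v → ρ x ≡ just v → τ x ≡ v

SameDomain : ∀ {n} → PartialAssignment n → PartialAssignment n → Set
SameDomain ρ ρ′ = ∀ x → Is-just (ρ x) ⇔ Is-just (ρ′ x)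

_⊨_ : ∀ {n} → Assignment n → Formula n → Set
α ⊨ H = All (Any λ ℓ → evalLiteral α ℓ ≡ true) H

Satisfiable : ∀ {n} → Formula n → Set
Satisfiable H = ∃[ α ] α ⊨ H

-- Restriction; nothing is the value 1 (the clause is satisfied).
restrictClause : ∀ {n} → Substitution n → Clause n → Maybe (Clause n)
restrictClause σ [] = just []
restrictClause σ (ℓ ∷ C) with σ ⟨ ℓ ⟩
... | const true  = nothing
... | const false = restrictClause σ C
... | lit ℓ′      = Maybe.map (ℓ′ ∷_) (restrictClause σ C)

_↾_ : ∀ {n} → Formula n → Substitution n → Formula n
Γ ↾ σ = mapMaybe (restrictClause σ) Γ

-- The partial assignment ¬C, with domain the variables of C.  It falsifies C
-- provided C is not a tautology; for tautologies the value is irrelevant, since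
-- every use below excludes or separates that case.
⟪¬_⟫ : ∀ {n} → Clause n → PartialAssignment n
⟪¬ C ⟫ x = if does (pos x ∈? C) then just false
           else if does (neg x ∈? C) then just true
           else nothing

-- Unit propagation derives the empty clause.  The assignment setting ℓ to 1 is
-- the one falsifying the clause [ ~ ℓ ].
data UnitRefutable {n : ℕ} (Γ : Formula n) : Set where
  conflict  : [] ∈ᶜ Γ → UnitRefutable Γ
  propagate : ∀ ℓ → [ ℓ ] ∈ᶜ Γ → UnitRefutable (Γ ↾ ⌜ ⟪¬ [ ~ ℓ ] ⟫ ⌝) → UnitRefutable Γ

-- Restricting by a substitution can produce a tautology, which no assignment
-- falsifies; it counts as derivable.
_⊢₁_ : ∀ {n} → Formula n → Clause n → Set
Γ ⊢₁ C = Tautology C ⊎ UnitRefutable (Γ ↾ ⌜ ⟪¬ C ⟫ ⌝)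

-- In the rest, the blocking variables are b 0, …, b (m - 1).

cost : ∀ {m n} → (Fin m → Fin n) → Assignment n → ℕ
cost b α = sum (tabulate λ i → if α (b i) then 1 else 0)

-- cost(H) = k
HasCost : ∀ {m n} → (Fin m → Fin n) → Formula n → ℕ → Set
HasCost b H k = (∃[ α ] α ⊨ H × cost b α ≡ k) × (∀ α → α ⊨ H → k ≤ cost b α)

-- The substitution σ witnesses that C is cost-SR with respect to Γ.  The clause C
-- must not be a tautology, as otherwise ¬C is not an assignment.
record CostRedundant {m n : ℕ} (b : Fin m → Fin n) (Γ : Formula n) (C : Clause n)
                     (σ : Substitution n) : Set where
  field
    nonTautology : ¬ Tautology C
    implied      : All ((Γ ↾ ⌜ ⟪¬ C ⟫ ⌝) ⊢₁_) ((C ∷ Γ) ↾ σ)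
    costMonotone : ∀ τ → τ ⊇ ⟪¬ C ⟫ → cost b (τ ⊙ σ) ≤ cost b τ

module _ {m n : ℕ} (b : Fin m → Fin n) (Γ : Formula n) where

  CostSR : Clause n → Set
  CostSR C = ∃[ σ ] CostRedundant b Γ C σ

  CostPR : Clause n → Set
  CostPR C = ∃[ ρ ] CostRedundant b Γ C ⌜ ρ ⌝

  CostSPR : Clause n → Set
  CostSPR C = ∃[ ρ ] CostRedundant b Γ C ⌜ ρ ⌝ × SameDomain ρ ⟪¬ C ⟫

  CostLPR : Clause n → Set
  CostLPR C = ∃[ ρ ] CostRedundant b Γ C ⌜ ρ ⌝ × SameDomain ρ ⟪¬ C ⟫
                   × ∃! _≡_ (λ x → ρ x ≢ ⟪¬ C ⟫ x)

  CostBC : Clause n → Set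
  CostBC E = ∃[ C ] ∃[ ℓ ] E ≈ ℓ ∷ C
                         × (∀ D → (~ ℓ ∷ D) ∈ᶜ Γ → Tautology (C ++ D))
                         × (∀ i → ℓ ≢ pos (b i))

data Redundancy : Set where
  cost-SR cost-PR cost-SPR cost-LPR cost-BC : Redundancy

Redundant : ∀ {m n} → Redundancy → (Fin m → Fin n) → Formula n → Clause n → Set
Redundant cost-SR  = CostSR
Redundant cost-PR  = CostPR
Redundant cost-SPR = CostSPR
Redundant cost-LPR = CostLPR
Redundant cost-BC  = CostBC

-- In split and merge, R is the multiset of the remaining soft clauses.
data Step {m n : ℕ} (P : Redundancy) (b : Fin m → Fin n) :
          Formula n × Formula n → Formula n × Formula n → Set where
  resolve   : ∀ {H S} x C D → (pos x ∷ C) ∈ᶜ H → (neg x ∷ D) ∈ᶜ H →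
              Step P b (H , S) ((C ++ D) ∷ H , S)
  weaken    : ∀ {H S} C D → C ∈ᶜ H → C ⊆ D → Step P b (H , S) (D ∷ H , S)
  redundant : ∀ {H S} C → Redundant P b H C → Step P b (H , S) (C ∷ H , S)
  soften    : ∀ {H S} C → C ∈ᶜ H → Step P b (H , S) (H , C ∷ S)
  split     : ∀ {H S} x C R → S ↭ C ∷ R →
              Step P b (H , S) (H , (pos x ∷ C) ∷ (neg x ∷ C) ∷ R)
  merge     : ∀ {H S} x C R → S ↭ (pos x ∷ C) ∷ (neg x ∷ C) ∷ R →
              Step P b (H , S) (H , C ∷ R)

Derivation : ∀ {m n} → Redundancy → (Fin m → Fin n) →
             Formula n × Formula n → Formula n × Formula n → Set
Derivation P b = Star (Step P b)

ContainsCopies : ∀ {n} → ℕ → Clause n → Formula n → Set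
ContainsCopies k C S = ∃[ R ] S ↭ replicate k C ++ R

hardClauses : ∀ {m n} → (Fin m → Fin n) → (Fin m → Clause n) → Formula n
hardClauses b C = tabulate λ i → pos (b i) ∷ C i

softClauses : ∀ {m n} → (Fin m → Fin n) → Formula n
softClauses b = tabulate λ i → [ neg (b i) ]

{-# OPTIONS --safe #-}
-- Weakening, softening, splitting and merging suffice.  Let N be a clause mentioning
-- every variable and α the assignment falsifying it.  If α falsifies a hard clause, then
-- N is a weakening of that clause and can be softened k times.  Otherwise α has cost at
-- least k, so at least k of the soft clauses ¬ b i yield N when split on all variables.
-- Either way k copies of each such N are available, and merging them yields k copies of ⊥.
module Submission where

open import Defs
open import Data.Bool using (true; false)
import Data.Bool.Properties as Bool
open import Data.Fin using (Fin; zero; suc)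
open import Data.List using (List; []; _∷_; [_]; _++_; map; replicate; allFin)
open import Data.List.Membership.Propositional using (_∈_; find)
open import Data.List.Membership.Propositional.Properties using (∈-allFin)
open import Data.List.Properties using (++-identityʳ; map-cong; map-id; map-replicate)
open import Data.List.Relation.Binary.Pointwise as Pointwise using (Pointwise)
open import Data.List.Relation.Binary.Permutation.Propositional using ()
  renaming (↭-sym to Prop↭-sym)
import Data.List.Relation.Binary.Permutation.Propositional.Properties as Propositional
open import Data.List.Relation.Binary.Permutation.Homogeneous using (prep)
import Data.List.Relation.Binary.Permutation.Setoid as SetoidPermutation
import Data.List.Relation.Binary.Permutation.Setoid.Properties as SetoidPermutationProperties
open import Data.List.Relation.Binary.Subset.Propositional using (_⊆_)
open import Data.List.Relation.Binary.Subset.Propositional.Properties using (⊆-refl)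
import Data.List.Relation.Unary.All as All
open import Data.List.Relation.Unary.All.Properties using (¬All⇒Any¬; ¬Any⇒All¬)
import Data.List.Relation.Unary.Any as Any
open import Data.List.Relation.Unary.Any using (Any; here; there)
open import Data.Nat using (ℕ; zero; suc; _≤_; z≤n; s≤s)
open import Data.Product using (_×_; _,_; ∃-syntax)
open import Data.Sum using (_⊎_; inj₁; inj₂)
open import Function using (_∘_; mk⇔)
open import Function.Definitions using (Injective)
open import Relation.Binary.Bundles using (Setoid)
open import Relation.Binary.Construct.Closure.ReflexiveTransitive using (ε; _◅_; _◅◅_; gmap)
open import Relation.Binary.PropositionalEquality using (_≡_; refl; sym; trans)
open import Relation.Nullary using (¬_; Dec; does; yes; no; contradiction)
open import Relation.Nullary.Decidable using (dec-true)

module _ {n : ℕ} where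
  open SetoidPermutation (clauseSetoid n) public
    using (↭-refl; ↭-sym; ↭-trans; ↭-prep; ↭-reflexive; ↭-reflexive-≋)
  open SetoidPermutationProperties (clauseSetoid n) public
    using (++-comm; ++-assoc; ↭-shift)
    renaming (++⁺ˡ to ↭-++⁺ˡ; ++⁺ʳ to ↭-++⁺ʳ)

≈-⊆ : ∀ {n} {C D : Clause n} → C ⊆ D → D ⊆ C → C ≈ D
≈-⊆ C⊆D D⊆C = mk⇔ C⊆D D⊆C

∈⇒∈ᶜ : ∀ {n} {C : Clause n} {H : Formula n} → C ∈ H → C ∈ᶜ H
∈⇒∈ᶜ = Any.map λ {refl → Setoid.refl (clauseSetoid _)}

++-swapʳ : ∀ {n} (S T U : Formula n) → (S ++ T) ++ U ↭ (S ++ U) ++ T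
++-swapʳ S T U =
  ↭-trans (++-assoc S T U) (↭-trans (↭-++⁺ˡ S (++-comm T U)) (↭-sym (++-assoc S U T)))

-- Clauses are compared as sets, so the literal of a split may be moved past `C` and join `N`. This
-- restores the shape `map (_++ N) S` at a child of the decision tree.
map-++-∷ : ∀ {n} (ℓ : Literal n) (N : Clause n) (S : Formula n) →
           map (ℓ ∷_) (map (_++ N) S) ↭ map (_++ (ℓ ∷ N)) S
map-++-∷ ℓ N S = ↭-reflexive-≋ (go S)
  where
  ℓ∷C++N≈ : ∀ C → (ℓ ∷ C ++ N) ≈ (C ++ ℓ ∷ N)
  ℓ∷C++N≈ C =
    let p = Propositional.shift ℓ C N
    in ≈-⊆ (Propositional.∈-resp-↭ (Prop↭-sym p)) (Propositional.∈-resp-↭ p)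

  go : ∀ S → Pointwise _≈_ (map (ℓ ∷_) (map (_++ N) S)) (map (_++ (ℓ ∷ N)) S)
  go []      = Pointwise.[]
  go (C ∷ S) = ℓ∷C++N≈ C Pointwise.∷ go S

module _ {m n : ℕ} {P : Redundancy} {b : Fin m → Fin n} where

  step-frame : ∀ {H H′ S S′} R → Step P b (H , S) (H′ , S′) → Step P b (H , S ++ R) (H′ , S′ ++ R)
  step-frame R (resolve x C D p q) = resolve x C D p q
  step-frame R (weaken C D p q)    = weaken C D p q
  step-frame R (redundant C p)     = redundant C p
  step-frame R (soften C p)        = soften C p
  step-frame R (split x C T p)     = split x C (T ++ R) (↭-++⁺ʳ R p)
  step-frame R (merge x C T p)     = merge x C (T ++ R) (↭-++⁺ʳ R p)

  derivation-frame : ∀ {H H′ S S′} R → Derivation P b (H , S) (H′ , S′) →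
                     Derivation P b (H , S ++ R) (H′ , S′ ++ R)
  derivation-frame R = gmap (λ (H , S) → H , S ++ R) (step-frame R)

  -- Splits and merges absorb the permutation into their premise. The other steps leave the order of
  -- the soft clauses as it is, so the result agrees only up to `_↭_`.
  step-resp-↭ : ∀ {H H′ S T T′} → S ↭ T → Step P b (H , T) (H′ , T′) →
                ∃[ S′ ] Step P b (H , S) (H′ , S′) × S′ ↭ T′
  step-resp-↭ S↭T (resolve x C D p q) = _ , resolve x C D p q , S↭T
  step-resp-↭ S↭T (weaken C D p q)    = _ , weaken C D p q , S↭T
  step-resp-↭ S↭T (redundant C p)     = _ , redundant C p , S↭T
  step-resp-↭ S↭T (soften C p)        = _ , soften C p , ↭-prep C S↭T
  step-resp-↭ S↭T (split x C R p)     = _ , split x C R (↭-trans S↭T p) , ↭-refl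
  step-resp-↭ S↭T (merge x C R p)     = _ , merge x C R (↭-trans S↭T p) , ↭-refl

  derivation-resp-↭ : ∀ {H H′ S T T′} → S ↭ T → Derivation P b (H , T) (H′ , T′) →
                      ∃[ S′ ] Derivation P b (H , S) (H′ , S′) × S′ ↭ T′
  derivation-resp-↭ S↭T ε        = _ , ε , S↭T
  derivation-resp-↭ S↭T (s ◅ ss) =
    let _ , s′ , U↭ = step-resp-↭ S↭T s
        _ , ss′ , S′↭T′ = derivation-resp-↭ U↭ ss
    in _ , s′ ◅ ss′ , S′↭T′

module SoftDerivation {m n : ℕ} (P : Redundancy) (b : Fin m → Fin n) (H₀ : Formula n) where

  infix 4 _⟹_

  -- Extra soft clauses R may be left over.  Quantifying over the hard clauses H lets
  -- derivations be composed although they add hard clauses.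
  _⟹_ : Formula n → Formula n → Set
  S ⟹ T = ∀ {H} → H₀ ⊆ H →
    ∃[ H′ ] ∃[ S′ ] H₀ ⊆ H′ × Derivation P b (H , S) (H′ , S′) × ∃[ R ] S′ ↭ T ++ R

  ↭⇒⟹ : ∀ {S} T R → S ↭ T ++ R → S ⟹ T
  ↭⇒⟹ T R p ⊆H = _ , _ , ⊆H , ε , R , p

  ↭⇒⟹₀ : ∀ {S T} → S ↭ T → S ⟹ T
  ↭⇒⟹₀ {S} {T} p = ↭⇒⟹ T [] (↭-trans p (↭-reflexive (sym (++-identityʳ T))))

  ⟹-trans : ∀ {S T U} → S ⟹ T → T ⟹ U → S ⟹ U
  ⟹-trans {U = U} S⟹T T⟹U ⊆H =
    let _ , _ , ⊆H′ , d , R , S′↭ = S⟹T ⊆H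
        _ , _ , ⊆H″ , e , Q , T′↭ = T⟹U ⊆H′
        -- The second derivation runs beside the leftovers `R` of the first, and its start is then
        -- reordered to match `S′`.
        _ , e′ , V↭ = derivation-resp-↭ S′↭ (derivation-frame R e)
    in _ , _ , ⊆H″ , d ◅◅ e′ , Q ++ R ,
       ↭-trans V↭ (↭-trans (↭-++⁺ʳ R T′↭) (++-assoc U Q R))

  ⟹-frame : ∀ {S T} R → S ⟹ T → S ++ R ⟹ T ++ R
  ⟹-frame {T = T} R S⟹T ⊆H =
    let _ , _ , ⊆H′ , d , Q , S′↭ = S⟹T ⊆H
    in _ , _ , ⊆H′ , derivation-frame R d , Q , ↭-trans (↭-++⁺ʳ R S′↭) (++-swapʳ T Q R)

  ⟹-++ : ∀ {S S′ T T′} → S ⟹ S′ → T ⟹ T′ → S ++ T ⟹ S′ ++ T′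
  ⟹-++ {S} {S′} {T} {T′} p q =
    ⟹-trans (⟹-frame T p)
      (⟹-trans (↭⇒⟹₀ (++-comm S′ T))
        (⟹-trans (⟹-frame S′ q) (↭⇒⟹₀ (++-comm T′ S′))))

  splitAll : ∀ x S → S ⟹ map (pos x ∷_) S ++ map (neg x ∷_) S
  splitAll x []      = ↭⇒⟹₀ ↭-refl
  splitAll x (C ∷ S) = ⟹-trans (⟹-++ splitHead (splitAll x S))
      -- Move `neg x ∷ C` behind the whole positive half.
      (↭⇒⟹₀ (↭-prep _ (↭-sym (↭-shift (map (pos x ∷_) S) _))))
    where
    splitHead : [ C ] ⟹ (pos x ∷ C) ∷ (neg x ∷ C) ∷ []
    splitHead ⊆H = _ , _ , ⊆H , split x C [] ↭-refl ◅ ε , [] , ↭-refl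

  mergeAll : ∀ x S → map (pos x ∷_) S ++ map (neg x ∷_) S ⟹ S
  mergeAll x []      = ↭⇒⟹₀ ↭-refl
  mergeAll x (C ∷ S) = ⟹-trans
      (↭⇒⟹₀ (↭-prep _ (↭-shift (map (pos x ∷_) S) _)))
      (⟹-++ mergeHead (mergeAll x S))
    where
    mergeHead : (pos x ∷ C) ∷ (neg x ∷ C) ∷ [] ⟹ [ C ]
    mergeHead ⊆H = _ , _ , ⊆H , merge x C [] ↭-refl ◅ ε , [] , ↭-refl

  weaken-soften : ∀ {C N} k → C ∈ H₀ → C ⊆ N → [] ⟹ replicate k N
  weaken-soften {C} {N} zero    C∈H₀ C⊆N = ↭⇒⟹₀ ↭-refl
  weaken-soften {C} {N} (suc k) C∈H₀ C⊆N = ⟹-++ one (weaken-soften k C∈H₀ C⊆N)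
    where
    one : [] ⟹ [ N ]
    one ⊆H = _ , _ , there ∘ ⊆H ,
      weaken C N (∈⇒∈ᶜ (⊆H C∈H₀)) C⊆N ◅ soften N (∈⇒∈ᶜ (here refl)) ◅ ε ,
      [] , ↭-refl

  -- Induction on the variables `xs` still to be decided; `N` collects the literals chosen on the
  -- path from the root. The number `k` is the same at all leaves, so the copies at two sibling
  -- nodes pair up and merge.
  decisionTree : ∀ k S →
    (∀ N → (∀ x → x occursIn N) → map (_++ N) S ⟹ replicate k N) →
    ∀ xs N → (∀ x → x ∈ xs ⊎ x occursIn N) → map (_++ N) S ⟹ replicate k N
  decisionTree k S leaf []       N total = leaf N λ x → occurs (total x)
    where
    occurs : ∀ {x} → x ∈ [] ⊎ x occursIn N → x occursIn N
    occurs (inj₂ p) = p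
  decisionTree k S leaf (x ∷ xs) N total =
    ⟹-trans (splitAll x (map (_++ N) S))
      (⟹-trans (⟹-++ (branch true) (branch false))
        (mergeAll x (replicate k N)))
    where
    total′ : ∀ s y → y ∈ xs ⊎ y occursIn ((x , s) ∷ N)
    total′ s y with total y
    total′ true  y | inj₁ (here refl) = inj₂ (inj₁ (here refl))
    total′ false y | inj₁ (here refl) = inj₂ (inj₂ (here refl))
    total′ s     y | inj₁ (there p)   = inj₁ p
    total′ s     y | inj₂ (inj₁ p)    = inj₂ (inj₁ (there p))
    total′ s     y | inj₂ (inj₂ p)    = inj₂ (inj₂ (there p))

    branch : ∀ s → map ((x , s) ∷_) (map (_++ N) S) ⟹ map ((x , s) ∷_) (replicate k N)
    branch s rewrite map-replicate ((x , s) ∷_) k N =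
      ⟹-trans (↭⇒⟹₀ (map-++-∷ (x , s) N S))
        (decisionTree k S leaf xs ((x , s) ∷ N) (total′ s))

falsifier : ∀ {n} → Clause n → Assignment n
falsifier N x = does (neg x ∈? N)

-- Some literal of each variable lies in `N`. If `pos x` is not true, then `neg x` is not in `N`, so
-- `pos x` is; `neg x` is not true only if it lies in `N`.
falsified-∈ : ∀ {n} {N : Clause n} → (∀ x → x occursIn N) →
              ∀ ℓ → ¬ evalLiteral (falsifier N) ℓ ≡ true → ℓ ∈ N
falsified-∈ {N = N} total (pos x) ℓ≢true with total x
... | inj₁ p = p
... | inj₂ p = contradiction (dec-true (neg x ∈? N) p) ℓ≢true
falsified-∈ {N = N} total (neg x) ℓ≢true with neg x ∈? N
... | yes p = p
... | no  _ = contradiction refl ℓ≢true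

ContainsCopies-≤ : ∀ {n j k} {C : Clause n} {S} → j ≤ k →
                   ContainsCopies k C S → ContainsCopies j C S
ContainsCopies-≤ {S = S} z≤n _ = S , ↭-refl
ContainsCopies-≤ {k = suc k} {C} (s≤s j≤k) (R , p) =
  let Q , q = ContainsCopies-≤ j≤k (R , ↭-refl) in Q , ↭-trans p (↭-prep C q)

-- A blocking variable counts towards the cost exactly when `neg (b i)` is in `N`, and then
-- `neg (b i) ∷ N` is `N` as a set.
softClauses-copies : ∀ {m n} (b : Fin m → Fin n) (N : Clause n) →
  ContainsCopies (cost b (falsifier N)) N (map (_++ N) (softClauses b))
softClauses-copies {zero}  b N = [] , ↭-refl
softClauses-copies {suc m} b N with neg (b zero) ∈? N | softClauses-copies (b ∘ suc) N
... | yes p | R , q = R , prep (≈-⊆ absorb there) q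
  where
  absorb : neg (b zero) ∷ N ⊆ N
  absorb (here refl) = p
  absorb (there r)   = r
... | no _  | R , q =
  _ , ↭-trans (↭-prep _ q) (↭-sym (↭-shift (replicate _ N) R))

theorem7p2 : (P : Redundancy) (m n : ℕ)
    (b : Fin m → Fin n) (C : Fin m → Clause n) →
    Injective _≡_ _≡_ b →
    (∀ i j → ¬ (b i occursIn C j)) →
    Satisfiable (hardClauses b C) →
    (k : ℕ) → HasCost b (hardClauses b C) k →
    ∃[ H ] ∃[ S ] (Derivation P b (hardClauses b C , softClauses b) (H , S)
    × ContainsCopies k [] S)
theorem7p2 P m n b C _ _ _ k (_ , k≤cost) =
  let H , S , _ , d , copies = derive ⊆-refl in H , S , d , copies
  where
  open SoftDerivation P b (hardClauses b C)

  satisfied? : ∀ α D → Dec (Any (λ ℓ → evalLiteral α ℓ ≡ true) D)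
  satisfied? α = Any.any? λ ℓ → evalLiteral α ℓ Bool.≟ true

  leaf : ∀ N → (∀ x → x occursIn N) → map (_++ N) (softClauses b) ⟹ replicate k N
  leaf N total with All.all? (satisfied? (falsifier N)) (hardClauses b C)
  ... | yes α⊨H =
    -- The cost may exceed `k`; surplus copies go into the leftovers.
    let R , p = ContainsCopies-≤ (k≤cost _ α⊨H) (softClauses-copies b N) in ↭⇒⟹ _ R p
  ... | no α⊭H =
    let D , D∈H , α⊭D = find (¬All⇒Any¬ (satisfied? (falsifier N)) _ α⊭H)
    -- All current soft clauses become leftovers, as the hard clause `D` alone supplies the copies.
    in ⟹-trans (↭⇒⟹ [] _ ↭-refl)
         (weaken-soften k D∈H λ {ℓ} ℓ∈D →
           falsified-∈ total ℓ (All.lookup (¬Any⇒All¬ D α⊭D) ℓ∈D))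

  derive : softClauses b ⟹ replicate k []
  -- At the root no literal has been chosen, so each soft clause is extended by the empty clause.
  derive = ⟹-trans (↭⇒⟹₀ (↭-reflexive (sym (trans (map-cong ++-identityʳ _) (map-id _)))))
    (decisionTree k (softClauses b) leaf (allFin n) [] (inj₁ ∘ ∈-allFin))
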